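{- Let $n,x$ be integers with $1<x<n$, so that $G=C_{2n}(x,1,n)$ is a $5$-regular circulant graph. If $\tfrac{n}{2}<x\leq \tfrac{2n}{3}$, then $G$ is word-representable and $R(G)\leq 5$.
   Context: Two distinct letters $x,y$ alternate in a word $w$ if, after deleting all other letters from $w$, the resulting word is of the form $xyxy\cdots$ or $yxyx\cdots$ (of even or odd length). A graph $G=(V,E)$ is word-representable if there is a word $w$ over the alphabet $V$, containing every letter of $V$ at least once, such that for all distinct $x,y\in V$, $xy\in E$ if and only if $x$ and $y$ alternate in $w$. A word is $k$-uniform if every letter occurs in it exactly $k$ times; $G$ is $k$-representable if some $k$-uniform word represents it, and the representation number $R(G)$ of a word-representable graph $G$ is the least such $k$. For an integer $m$ and a set $R$ of positive integers each at most $m/2$, the circulant graph $C_m(R)$ has vertex set $\{0,1,\dots,m-1\}$, with $i$ and $j$ adjacent iff $\min(|i-j|,\,m-|i-j|)\in R$. $C_{2n}(x,1,n)$ denotes the circulant graph on $2n$ vertices with jump set $\{1,x,n\}$; it is $5$-regular exactly when $1<x<n$. -}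

module Defs where

open import Data.Fin.Base using (Fin; toℕ)
open import Data.Fin.Properties using (_≟_)
open import Data.List.Base using (List; []; _∷_; filter; length)
open import Data.List.Membership.Propositional using (_∈_)
open import Data.List.Relation.Unary.All as All using (All; []; _∷_)
open import Data.Nat.Base using (ℕ; _*_; _∸_; _⊓_; ∣_-_∣; _<_; _≤_; z<s)
open import Data.Nat.Properties
  using (*-monoʳ-≤; <⇒≤; <-trans; ≤-refl; <-irrefl; ∣-∣-comm; ∣n-n∣≡0)
open import Data.Product.Base using (∃-syntax; _×_; _,_; proj₁)
open import Data.Sum.Base using (_⊎_)
open import Function.Bundles using (_⇔_)
open import Relation.Binary.PropositionalEquality
  using (_≡_; _≢_; refl; subst)
open import Relation.Nullary using (¬_)
open import Relation.Nullary.Decidable using (_⊎-dec_)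

record Graph (m : ℕ) : Set₁ where
  field
    Adj       : Fin m → Fin m → Set
    symmetric : ∀ {i j} → Adj i j → Adj j i
    loopless  : ∀ {i} → ¬ Adj i i

open Graph public

Word : ℕ → Set
Word m = List (Fin m)

-- AltFrom x y w : w is a finite prefix of x y x y ⋯
data AltFrom {A : Set} : A → A → List A → Set where
  []  : ∀ {x y} → AltFrom x y []
  _∷_ : ∀ x {y w} → AltFrom y x w → AltFrom x y (x ∷ w)

restrict : ∀ {m} → Fin m → Fin m → Word m → Word m
restrict x y = filter (λ z → (z ≟ x) ⊎-dec (z ≟ y))

Alternate : ∀ {m} → Fin m → Fin m → Word m → Set
Alternate x y w = AltFrom x y (restrict x y w) ⊎ AltFrom y x (restrict x y w)

Represents : ∀ {m} → Word m → Graph m → Set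
Represents w G =
  (∀ x → x ∈ w) × (∀ x y → x ≢ y → Adj G x y ⇔ Alternate x y w)

WordRepresentable : ∀ {m} → Graph m → Set
WordRepresentable {m} G = ∃[ w ] Represents {m} w G

occurrences : ∀ {m} → Fin m → Word m → ℕ
occurrences x w = length (filter (x ≟_) w)

Uniform : ∀ {m} → ℕ → Word m → Set
Uniform k w = ∀ x → occurrences x w ≡ k

Representable : ∀ {m} → ℕ → Graph m → Set
Representable {m} k G = ∃[ w ] Uniform {m} k w × Represents w G

-- The representation number as a relation, since it is defined only for
-- word-representable graphs: k is the least number with G k-representable.
IsRepresentationNumber : ∀ {m} → Graph m → ℕ → Set
IsRepresentationNumber G k =
  Representable k G × (∀ j → Representable j G → k ≤ j)

circularDistance : ∀ {m} → Fin m → Fin m → ℕ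
circularDistance {m} i j = ∣ toℕ i - toℕ j ∣ ⊓ (m ∸ ∣ toℕ i - toℕ j ∣)

-- Jump sets are lists read up to membership; r ≤ m/2 is written 2 * r ≤ m.
ValidJump : ℕ → ℕ → Set
ValidJump m r = 0 < r × 2 * r ≤ m

circulant : (m : ℕ) (R : List ℕ) → All (ValidJump m) R → Graph m
circulant m R valid = record
  { Adj       = λ i j → circularDistance i j ∈ R
  ; symmetric = λ {i} {j} →
      subst (λ d → d ⊓ (m ∸ d) ∈ R) (∣-∣-comm (toℕ i) (toℕ j))
  ; loopless  = λ {i} d∈R → <-irrefl refl
      (proj₁ (All.lookup valid
        (subst (λ d → d ⊓ (m ∸ d) ∈ R) (∣n-n∣≡0 (toℕ i)) d∈R)))
  }

circulant₂ₙ : (n x : ℕ) → 1 < x → x < n → Graph (2 * n)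
circulant₂ₙ n x 1<x x<n = circulant (2 * n) (x ∷ 1 ∷ n ∷ [])
  ( (0<x , *-monoʳ-≤ 2 (<⇒≤ x<n))
  ∷ (z<s , *-monoʳ-≤ 2 0<n)
  ∷ (0<n , ≤-refl)
  ∷ [])
  where
  0<x : 0 < x
  0<x = <-trans z<s 1<x
  0<n : 0 < n
  0<n = <-trans 0<x x<n

{-# OPTIONS --safe #-}
module Submission where

-- G is represented by the cyclic word whose block q, for q = 0, …, 2n − 1, is
--   q  (q − x + 1)  (q − x)  (q − 2x + 1)  (q − n − x + 1)   (letters modulo 2n).
-- Letters i and i + d occur at translates by 5i and 5(i + d) of one progression P of
-- period 10n whose successive gaps are 5x − 4, 6, 5x − 4, 5(n − x) + 1, 5(n − x) + 1.
-- For d = 1, x, n the translate P + 5d interlaces with P, its points lying zero, one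
-- and two steps further on; for d = x and d = n this is where n/2 < x ≤ 2n/3 enters.
-- Conversely the word contains the factor
--   i  (i − 1)  (i − x)  (i − n)  (i + x)  (i + 1)  i
-- for every letter i but the one whose factor wraps around, so a letter not adjacent
-- to i cannot alternate with it; of two letters at least one has its factor.
-- The least k exists since k-representability is decidable by bounded search.

open import Defs
open import Data.Fin.Base using (Fin; toℕ; zero; suc)
open import Data.Fin.Patterns using (0F; 1F; 2F; 3F; 4F)
open import Data.Fin.Properties as Fin using (_≟_; toℕ-fromℕ<; toℕ-injective; toℕ<n)
open import Data.List.Base using (List; []; _∷_; _++_; [_]; filter; length; applyUpTo)
import Data.List.Membership.DecPropositional as DecMembership
open import Data.List.Membership.Propositional using (_∈_)
open import Data.List.Membership.Propositional.Properties using (∈-filter⁻; ∈-applyUpTo⁻)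
open import Data.List.Properties
  using (filter-accept; filter-reject; filter-≐; filter-++; length-++; applyUpTo-∷ʳ)
open import Data.List.Relation.Unary.All using (All; []; _∷_)
open import Data.List.Relation.Unary.Any using (here; there)
open import Data.Nat.Base
open import Data.Nat.DivMod
open import Data.Nat.Properties as ℕ hiding (_≟_)
open import Data.Nat.Tactic.RingSolver using (solve-∀)
open import Data.Product.Base using (∃-syntax; _×_; _,_; proj₁; proj₂)
open import Data.Sum.Base using (_⊎_; inj₁; inj₂; [_,_]′; swap)
open import Function.Base using (_∘_)
open import Function.Bundles using (_⇔_; mk⇔; Equivalence)
open import Relation.Binary.Definitions using (DecidableEquality)
open import Relation.Binary.PropositionalEquality hiding ([_])
open import Relation.Nullary using (¬_; Dec; yes; no; contradiction)
open import Relation.Nullary.Decidable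
  using (True; toWitness; decidable-stable; map′; _×-dec_; _⊎-dec_; _→-dec_; ¬?)
open import Relation.Unary using (Decidable)

-- Alternation in words

module _ {m : ℕ} where

  Alternate-sym : ∀ {x y : Fin m} {w} → Alternate x y w → Alternate y x w
  Alternate-sym {x} {y} {w}
    rewrite filter-≐ (λ z → (z ≟ y) ⊎-dec (z ≟ x)) (λ z → (z ≟ x) ⊎-dec (z ≟ y))
                     (swap , swap) w = swap

  restrict-keepˡ : ∀ (x y : Fin m) w → restrict x y (x ∷ w) ≡ x ∷ restrict x y w
  restrict-keepˡ x y w = filter-accept (λ z → (z ≟ x) ⊎-dec (z ≟ y)) (inj₁ refl)

  restrict-drop : ∀ {x y z : Fin m} w → z ≢ x → z ≢ y →
                  restrict x y (z ∷ w) ≡ restrict x y w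
  restrict-drop {x} {y} w z≢x z≢y =
    filter-reject (λ z → (z ≟ x) ⊎-dec (z ≟ y)) [ z≢x , z≢y ]′

  Alternate-tail : ∀ {x y z : Fin m} {w} → Alternate x y (z ∷ w) → Alternate x y w
  Alternate-tail {x} {y} {z} alt with z ≟ x | z ≟ y | alt
  ... | no _     | no _     | alt′         = alt′
  ... | yes refl | _        | inj₁ (_ ∷ a) = inj₂ a
  ... | yes refl | _        | inj₂ (_ ∷ a) = inj₁ a
  ... | no _     | yes refl | inj₁ (_ ∷ a) = inj₂ a
  ... | no _     | yes refl | inj₂ (_ ∷ a) = inj₁ a

  -- Restricting to the two letters leaves two copies of `x` side by side. If `mid` itself contains
  -- `x`, the argument restarts from that later occurrence; every other letter of `mid` is erased by
  -- the restriction.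
  repeat⇒¬Alternate : ∀ {x y : Fin m} mid {post} → x ≢ y → All (_≢ y) mid →
                      ¬ Alternate x y (x ∷ mid ++ x ∷ post)
  repeat⇒¬Alternate {x} {y} [] {post} x≢y [] alt
    rewrite restrict-keepˡ x y (x ∷ post) | restrict-keepˡ x y post with alt
  ... | inj₁ (_ ∷ (_ ∷ _)) = x≢y refl
  ... | inj₂ (_ ∷ (_ ∷ _)) = x≢y refl
  repeat⇒¬Alternate {x} {y} (z ∷ mid) {post} x≢y (z≢y ∷ mid≢y) alt with z ≟ x
  ... | yes refl = repeat⇒¬Alternate mid x≢y mid≢y (Alternate-tail {z = x} alt)
  ... | no z≢x = repeat⇒¬Alternate mid x≢y mid≢y
      (subst₂ _⊎_ (cong (AltFrom x y) eq) (cong (AltFrom y x) eq) alt)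
    where
    rest : Word m
    rest = mid ++ x ∷ post
    eq : restrict x y (x ∷ z ∷ rest) ≡ restrict x y (x ∷ rest)
    eq = trans (restrict-keepˡ x y (z ∷ rest))
           (trans (cong (x ∷_) (restrict-drop rest z≢x z≢y)) (sym (restrict-keepˡ x y rest)))

  -- Alternation from interlaced positions

  Separates : Fin m → Fin m → (ℕ → Fin m) → Set
  Separates y x f = ∀ {s t} → s < t → f s ≡ x → f t ≡ x →
                    ∃[ u ] s < u × u < t × f u ≡ y

  Separates-tail : ∀ {x y f} → Separates y x f → Separates y x (f ∘ suc)
  Separates-tail sep s<t fs ft with sep (s≤s s<t) fs ft
  ... | suc u , s≤s s<u , s≤s u<t , fu = u , s<u , u<t , fu

  restrict-head : ∀ {x y z r} (f : ℕ → Fin m) L → restrict x y (applyUpTo f L) ≡ z ∷ r →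
                  ∃[ t ] f t ≡ z × (∀ {u} → u < t → f u ≢ x × f u ≢ y)
  restrict-head {x} {y} f (suc L) eq with f 0 ≟ x | f 0 ≟ y
  restrict-head {x} {y} f (suc L) refl | yes _ | _ = 0 , refl , λ ()
  restrict-head {x} {y} f (suc L) refl | no _ | yes _ = 0 , refl , λ ()
  restrict-head {x} {y} f (suc L) eq | no f0≢x | no f0≢y
    with restrict-head (f ∘ suc) L eq
  ... | t , ft , before = suc t , ft , before′
    where
    before′ : ∀ {u} → u < suc t → f u ≢ x × f u ≢ y
    before′ {zero}  _         = f0≢x , f0≢y
    before′ {suc _} (s≤s u<t) = before u<t

  -- The restricted tail cannot begin with `x`: separation would put a `y` between position 0 and
  -- that `x`, although the `x` is the first of the two letters to occur in the tail.
  AltFrom-tail : ∀ {x y : Fin m} f L → f 0 ≡ x → Separates y x f →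
                 Alternate x y (applyUpTo (f ∘ suc) L) →
                 AltFrom y x (restrict x y (applyUpTo (f ∘ suc) L))
  AltFrom-tail f L f0 sep (inj₂ a) = a
  AltFrom-tail {x} {y} f L f0 sep (inj₁ a)
    with restrict x y (applyUpTo (f ∘ suc) L) in eq | a
  ... | [] | [] = []
  ... | _ ∷ _ | _ ∷ _ with restrict-head (f ∘ suc) L eq
  ...   | t , ft , before with sep (z<s {t}) f0 ft
  ...     | suc u , _ , s≤s u<t , fu = contradiction fu (proj₂ (before u<t))

  Separates⇒Alternate : ∀ {x y : Fin m} f L → Separates y x f → Separates x y f →
                        Alternate x y (applyUpTo f L)
  Separates⇒Alternate f zero _ _ = inj₁ []
  Separates⇒Alternate {x} {y} f (suc L) sepʸ sepˣ with f 0 ≟ x | f 0 ≟ y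
     | Separates⇒Alternate (f ∘ suc) L (Separates-tail sepʸ) (Separates-tail sepˣ)
  ... | yes refl | _ | ih = inj₁ (f 0 ∷ AltFrom-tail f L refl sepʸ ih)
  ... | no f0≢x | no f0≢y | ih = ih
  ... | no f0≢x | yes refl | ih = inj₂ (f 0 ∷
      subst (AltFrom x y) (sym eq) (AltFrom-tail f L refl sepˣ (Alternate-sym {w = w} ih)))
    where
    w = applyUpTo (f ∘ suc) L
    eq : restrict x y w ≡ restrict y x w
    eq = filter-≐ (λ z → (z ≟ x) ⊎-dec (z ≟ y)) (λ z → (z ≟ y) ⊎-dec (z ≟ x)) (swap , swap) w

  -- A and B enumerate occurrences of x and y, exhaustively from position T on.
  interlaced⇒Alternate : ∀ {x y : Fin m} (W : ℕ → Fin m) T (A B : ℕ → ℕ) r →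
    (∀ k → W (A k) ≡ x) → (∀ k → W (B k) ≡ y) →
    (∀ t → W (T + t) ≡ x → ∃[ k ] T + t ≡ A (k + r)) →
    (∀ t → W (T + t) ≡ y → ∃[ k ] T + t ≡ B k) →
    (∀ k → A (k + r) < B k × B k < A (suc k + r)) →
    ∀ L → Alternate x y (applyUpTo (λ t → W (T + t)) L)
  interlaced⇒Alternate {x} {y} W T A B r WA WB A-all B-all A<B<A L =
    Separates⇒Alternate _ L sepʸ sepˣ
    where
    monotone : ∀ (f : ℕ → ℕ) → (∀ k → f k < f (suc k)) → ∀ {j k} → j ≤′ k → f j ≤ f k
    monotone f step (≤′-reflexive refl) = ≤-refl
    monotone f step (≤′-step j≤k) = ≤-trans (monotone f step j≤k) (<⇒≤ (step _))

    next : ∀ (f : ℕ → ℕ) → (∀ k → f k < f (suc k)) → ∀ {j k} → f j < f k → f (suc j) ≤ f k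
    next f step {j} {k} fj<fk with j <? k
    ... | yes j<k = monotone f step (≤⇒≤′ j<k)
    ... | no  j≮k = contradiction (monotone f step (≤⇒≤′ (≮⇒≥ j≮k))) (<⇒≱ fj<fk)

    between : ∀ {s t p z} → T + s < p → p < T + t → W p ≡ z →
              ∃[ u ] s < u × u < t × W (T + u) ≡ z
    between {s} s<p p<t Wp with m≤n⇒∃[o]m+o≡n (≤-trans (m≤m+n T s) (<⇒≤ s<p))
    ... | u , refl = u , +-cancelˡ-< T _ _ s<p , +-cancelˡ-< T _ _ p<t , Wp

    sepʸ : Separates y x (λ t → W (T + t))
    -- The separating occurrence is `B j`: it precedes `A (suc j + r)`, which is at most
    -- `A (k + r)`. In `sepˣ` the same role is played by `A (suc j + r)`.
    sepʸ {s} {t} s<t Ws Wt with A-all s Ws | A-all t Wt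
    ... | j , s≡ | k , t≡ = between
      (≤-<-trans (≤-reflexive s≡) (proj₁ (A<B<A j)))
      (<-≤-trans (proj₂ (A<B<A j))
        (≤-trans
          (next (λ k → A (k + r)) (λ k → <-trans (proj₁ (A<B<A k)) (proj₂ (A<B<A k)))
            {j} {k} (subst₂ _<_ s≡ t≡ (+-monoʳ-< T s<t)))
          (≤-reflexive (sym t≡))))
      (WB j)

    sepˣ : Separates x y (λ t → W (T + t))
    sepˣ {s} {t} s<t Ws Wt with B-all s Ws | B-all t Wt
    ... | j , s≡ | k , t≡ = between
      (≤-<-trans (≤-reflexive s≡) (proj₂ (A<B<A j)))
      (<-≤-trans (proj₁ (A<B<A (suc j)))
        (≤-trans
          (next B (λ k → <-trans (proj₂ (A<B<A k)) (proj₁ (A<B<A (suc k))))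
            {j} {k} (subst₂ _<_ s≡ t≡ (+-monoʳ-< T s<t)))
          (≤-reflexive (sym t≡))))
      (WA (suc j + r))

  -- Counting occurrences

  occurrences-∷ : ∀ (i x : Fin m) w → occurrences i (x ∷ w) ≡ occurrences i [ x ] + occurrences i w
  occurrences-∷ i x w = trans (cong length (filter-++ (i ≟_) [ x ] w)) (length-++ (filter (i ≟_) [ x ]))

  occurrences-∷ʳ : ∀ (i x : Fin m) w → occurrences i (w ++ [ x ]) ≡ occurrences i [ x ] + occurrences i w
  occurrences-∷ʳ i x w = trans (cong length (filter-++ (i ≟_) w [ x ]))
    (trans (length-++ (filter (i ≟_) w)) (+-comm (occurrences i w) _))

  occurrences-≡0 : ∀ {i : Fin m} {f} L → (∀ {t} → t < L → f t ≢ i) → occurrences i (applyUpTo f L) ≡ 0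
  occurrences-≡0 zero _ = refl
  occurrences-≡0 {i} {f} (suc L) f≢i with i ≟ f 0
  ... | yes i≡f0 = contradiction (sym i≡f0) (f≢i z<s)
  ... | no  _    = occurrences-≡0 L (f≢i ∘ s≤s)

  occurs⇒∈ : ∀ {i : Fin m} {w k} → occurrences i w ≡ suc k → i ∈ w
  occurs⇒∈ {i} {w} occ with filter (i ≟_) w in eq
  ... | z ∷ _ with ∈-filter⁻ (i ≟_) {xs = w} (subst (z ∈_) (sym eq) (here refl))
  ...   | z∈w , refl = z∈w

applyUpTo-cong : ∀ {A : Set} {f g : ℕ → A} → f ≗ g → applyUpTo f ≗ applyUpTo g
applyUpTo-cong f≗g zero    = refl
applyUpTo-cong f≗g (suc n) = cong₂ _∷_ (f≗g 0) (applyUpTo-cong (f≗g ∘ suc) n)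

-- Representability by k-uniform words is decidable

altFrom? : ∀ {A : Set} → DecidableEquality A → (x y : A) (w : List A) → Dec (AltFrom x y w)
altFrom? _≟ᴬ_ x y [] = yes []
altFrom? _≟ᴬ_ x y (z ∷ w) with x ≟ᴬ z
... | no x≢z = no λ where (_ ∷ _) → x≢z refl
... | yes refl = map′ (x ∷_) (λ where (_ ∷ a) → a) (altFrom? _≟ᴬ_ y x w)

alternate? : ∀ {m} (x y : Fin m) w → Dec (Alternate x y w)
alternate? x y w = altFrom? _≟_ x y _ ⊎-dec altFrom? _≟_ y x _

sum : ∀ {m} → (Fin m → ℕ) → ℕ
sum {zero}  f = 0
sum {suc m} f = f zero + sum (f ∘ suc)

sum-mono : ∀ {m} {f g : Fin m → ℕ} → (∀ i → f i ≤ g i) → sum f ≤ sum g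
sum-mono {zero}  f≤g = z≤n
sum-mono {suc m} f≤g = +-mono-≤ (f≤g zero) (sum-mono (f≤g ∘ suc))

sum-mono-< : ∀ {m} {f g : Fin m → ℕ} i → f i < g i → (∀ j → f j ≤ g j) → sum f < sum g
sum-mono-< zero    f<g f≤g = +-mono-<-≤ f<g (sum-mono (f≤g ∘ suc))
sum-mono-< (suc i) f<g f≤g = +-mono-≤-< (f≤g zero) (sum-mono-< i f<g (f≤g ∘ suc))

sum-≡ : ∀ {m k} {f : Fin m → ℕ} → (∀ i → f i ≡ k) → sum f ≡ m * k
sum-≡ {zero}  f≡k = refl
sum-≡ {suc m} f≡k = cong₂ _+_ (f≡k zero) (sum-≡ (f≡k ∘ suc))

-- Bounds the length of a `k`-uniform word by `m * k`, which makes the search for one finite.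
length≤sum-occurrences : ∀ {m} (w : Word m) → length w ≤ sum (λ i → occurrences i w)
length≤sum-occurrences [] = z≤n
length≤sum-occurrences {m} (x ∷ w) =
  ≤-<-trans (length≤sum-occurrences w) (sum-mono-< x here′ there′)
  where
  here′ : occurrences x w < occurrences x (x ∷ w)
  here′ with x ≟ x
  ... | yes _  = ≤-refl
  ... | no x≢x = contradiction refl x≢x
  there′ : ∀ i → occurrences i w ≤ occurrences i (x ∷ w)
  there′ i with i ≟ x
  ... | yes _ = n≤1+n _
  ... | no  _ = ≤-refl

anyWord? : ∀ {m} {P : Word m → Set} → Decidable P → ∀ L → Dec (∃[ w ] length w ≤ L × P w)
anyWord? P? zero = map′ (λ p → [] , z≤n , p) (λ where ([] , _ , p) → p) (P? [])
anyWord? P? (suc L) = map′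
  [ (λ p → [] , z≤n , p) , (λ where (x , w , ≤L , p) → x ∷ w , s≤s ≤L , p) ]′
  (λ where
    ([] , _ , p)         → inj₁ p
    (x ∷ w , s≤s ≤L , p) → inj₂ (x , w , ≤L , p))
  (P? [] ⊎-dec Fin.any? λ x → anyWord? (P? ∘ (x ∷_)) L)

module _ {m} (G : Graph m) (adj? : ∀ i j → Dec (Adj G i j)) where
  open DecMembership (_≟_ {m}) using (_∈?_)

  _⇔-dec_ : ∀ {A B : Set} → Dec A → Dec B → Dec (A ⇔ B)
  a? ⇔-dec b? = map′ (λ (f , g) → mk⇔ f g) (λ e → Equivalence.to e , Equivalence.from e)
                  ((a? →-dec b?) ×-dec (b? →-dec a?))

  represents? : Decidable (λ w → Represents w G)
  represents? w = Fin.all? (_∈? w) ×-dec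
    Fin.all? (λ x → Fin.all? λ y → ¬? (x ≟ y) →-dec (adj? x y ⇔-dec alternate? x y w))

  representable? : Decidable (λ k → Representable k G)
  representable? k = map′
    (λ (w , _ , p) → w , p)
    (λ (w , uni , rep) → w ,
      ≤-trans (length≤sum-occurrences w) (≤-reflexive (sum-≡ uni)) , uni , rep)
    (anyWord? (λ w → Fin.all? (λ x → occurrences x w ℕ.≟ k) ×-dec represents? w)
             (m * k))

least : ∀ {P : ℕ → Set} → Decidable P → ∀ {n} → P n →
        ∃[ k ] (P k × (∀ j → P j → k ≤ j)) × k ≤ n
least P? {zero} p = 0 , (p , λ _ _ → z≤n) , z≤n
least P? {suc n} p with P? 0 | least (P? ∘ suc) p
... | yes p₀ | _ = 0 , (p₀ , λ _ _ → z≤n) , z≤n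
... | no ¬p₀ | k , (pₖ , min) , k≤n = suc k , (pₖ , λ where
    zero p₀ → contradiction p₀ ¬p₀
    (suc j) pⱼ → s≤s (min j pⱼ)) , s≤s k≤n

-- Circular distance

circularDistance-sym : ∀ {m} (i j : Fin m) → circularDistance i j ≡ circularDistance j i
circularDistance-sym {m} i j = cong (λ d → d ⊓ (m ∸ d)) (∣-∣-comm (toℕ i) (toℕ j))

module _ {M : ℕ} .{{_ : NonZero M}} where

  toℕ-mod : ∀ a → toℕ (a mod M) ≡ a % M
  toℕ-mod a = toℕ-fromℕ< (m%n<n a M)

  mod-cong : ∀ {a b} → a % M ≡ b % M → a mod M ≡ b mod M
  mod-cong {a} {b} eq = toℕ-injective (trans (toℕ-mod a) (trans eq (sym (toℕ-mod b))))

  mod-+M : ∀ a → (a + M) mod M ≡ a mod M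
  mod-+M a = mod-cong {a + M} {a} ([m+n]%n≡m%n a M)

  toℕ-mod-id : ∀ (i : Fin M) → toℕ i mod M ≡ i
  toℕ-mod-id i = toℕ-injective (trans (toℕ-mod (toℕ i)) (m<n⇒m%n≡m (toℕ<n i)))

  mod-≡⇒multiple : ∀ {a b} → a ≤ b → a mod M ≡ b mod M → ∃[ v ] b ≡ a + v * M
  mod-≡⇒multiple {a} {b} a≤b eq = b / M ∸ a / M , (begin
    b                                              ≡⟨ m≡m%n+[m/n]*n b M ⟩
    b % M + b / M * M
      ≡⟨ cong₂ (λ r q → r + q * M) (sym %-eq) (sym (m+[n∸m]≡n (/-monoˡ-≤ M a≤b))) ⟩
    a % M + (a / M + (b / M ∸ a / M)) * M          ≡⟨ cong (a % M +_) (*-distribʳ-+ M (a / M) _) ⟩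
    a % M + (a / M * M + (b / M ∸ a / M) * M)      ≡⟨ +-assoc (a % M) _ _ ⟨
    a % M + a / M * M + (b / M ∸ a / M) * M        ≡⟨ cong (_+ (b / M ∸ a / M) * M) (m≡m%n+[m/n]*n a M) ⟨
    a + (b / M ∸ a / M) * M                        ∎)
    where
    open ≡-Reasoning
    %-eq : a % M ≡ b % M
    %-eq = trans (sym (toℕ-mod a)) (trans (cong toℕ eq) (toℕ-mod b))

  -- Either `a % M + d` stays below `M` and the residues differ by `d`, or it wraps once and they
  -- differ by `M ∸ d`. As `2 * d ≤ M`, the minimum is `d` both times.
  circularDistance-mod : ∀ a d → 2 * d ≤ M → circularDistance (a mod M) ((a + d) mod M) ≡ d
  circularDistance-mod a d 2d≤M = trans
    (cong (λ D → D ⊓ (M ∸ D)) (cong₂ ∣_-_∣ (toℕ-mod a) (trans (toℕ-mod (a + d)) [a+d]%M)))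
    (distance (r + d <? M))
    where
    r = a % M
    r<M : r < M
    r<M = m%n<n a M
    d+d≤M : d + d ≤ M
    d+d≤M = subst (_≤ M) (cong (d +_) (+-identityʳ d)) 2d≤M
    d≤M∸d : d ≤ M ∸ d
    d≤M∸d = m+n≤o⇒m≤o∸n d d+d≤M
    d≤M : d ≤ M
    d≤M = m+n≤o⇒m≤o d d+d≤M
    [a+d]%M : (a + d) % M ≡ (r + d) % M
    [a+d]%M = trans (cong (_% M) (trans (cong (_+ d) (m≡m%n+[m/n]*n a M))
        (trans (+-assoc r _ d) (trans (cong (r +_) (+-comm _ d)) (sym (+-assoc r d _))))))
      ([m+kn]%n≡m%n (r + d) (a / M) M)
    distance : Dec (r + d < M) → ∣ r - (r + d) % M ∣ ⊓ (M ∸ ∣ r - (r + d) % M ∣) ≡ d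
    distance (yes r+d<M) = trans
      (cong (λ D → D ⊓ (M ∸ D)) (trans (cong (∣ r -_∣) (m<n⇒m%n≡m r+d<M)) (∣m-m+n∣≡n r d)))
      (m≤n⇒m⊓n≡m d≤M∸d)
    distance (no r+d≮M) with m≤n⇒∃[o]m+o≡n (≮⇒≥ r+d≮M)
    ... | c , M+c≡r+d = trans
      (cong (λ D → D ⊓ (M ∸ D)) (trans (cong₂ ∣_-_∣ r≡ [r+d]%M≡c)
        (trans (∣-∣-comm (c + (M ∸ d)) c) (∣m-m+n∣≡n c (M ∸ d)))))
      (trans (cong ((M ∸ d) ⊓_) (m∸[m∸n]≡n d≤M)) (m≥n⇒m⊓n≡n d≤M∸d))
      where
      r≡ : r ≡ c + (M ∸ d)
      r≡ = +-cancelʳ-≡ d r _ (trans (sym M+c≡r+d) (trans (+-comm M c)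
        (trans (cong (c +_) (sym (m∸n+n≡m d≤M))) (sym (+-assoc c _ d)))))
      c<M : c < M
      c<M = ≤-<-trans (≤-trans (m≤m+n c _) (≤-reflexive (sym r≡))) r<M
      [r+d]%M≡c : (r + d) % M ≡ c
      [r+d]%M≡c = trans (cong (_% M) (trans (sym M+c≡r+d) (+-comm M c)))
                        (trans ([m+n]%n≡m%n c M) (m<n⇒m%n≡m c<M))

  -- A directed step on natural representatives, so that `a` and `a + d` can be used as translations
  -- of one progression. The bound on `a` keeps `a + d` below `2 * M` when `d ≤ M`.
  Shift : ℕ → Fin M → Fin M → Set
  Shift d i j = ∃[ a ] a < M × a mod M ≡ i × (a + d) mod M ≡ j

  -- The minimum selects the direction: `D` leads forward from `i` to `j`, and `M ∸ D` leads from
  -- `j` across the wrap to `i`.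
  ordered⇒Shift : ∀ {i j : Fin M} → toℕ i ≤ toℕ j →
    let d = circularDistance i j in Shift d i j ⊎ Shift d j i
  ordered⇒Shift {i} {j} i≤j with ∣ toℕ i - toℕ j ∣ in eq | m≤n⇒∣m-n∣≡n∸m i≤j
  ... | D | D≡ with ≤-total D (M ∸ D)
  ...   | inj₁ D≤ rewrite m≤n⇒m⊓n≡m D≤ = inj₁ (toℕ i , toℕ<n i , toℕ-mod-id i ,
          trans (cong (_mod M) (trans (cong (toℕ i +_) D≡) (m+[n∸m]≡n i≤j))) (toℕ-mod-id j))
  ...   | inj₂ D≥ rewrite m≥n⇒m⊓n≡n D≥ = inj₂ (toℕ j , toℕ<n j , toℕ-mod-id j ,
          trans (cong (_mod M) j+≡) (trans (mod-+M (toℕ i)) (toℕ-mod-id i)))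
    where
    j≡ : toℕ j ≡ toℕ i + D
    j≡ = sym (trans (cong (toℕ i +_) D≡) (m+[n∸m]≡n i≤j))
    D≤M : D ≤ M
    D≤M = ≤-trans (≤-trans (m≤n+m D (toℕ i)) (≤-reflexive (sym j≡))) (<⇒≤ (toℕ<n j))
    j+≡ : toℕ j + (M ∸ D) ≡ toℕ i + M
    j+≡ = trans (cong (_+ (M ∸ D)) j≡) (trans (+-assoc (toℕ i) D _) (cong (toℕ i +_) (m+[n∸m]≡n D≤M)))

  circularDistance⇒Shift : ∀ (i j : Fin M) →
    let d = circularDistance i j in Shift d i j ⊎ Shift d j i
  circularDistance⇒Shift i j with ≤-total (toℕ i) (toℕ j)
  ... | inj₁ i≤j = ordered⇒Shift i≤j
  ... | inj₂ j≤i rewrite circularDistance-sym i j = swap (ordered⇒Shift j≤i)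

-- The representing word

-- The count does not depend on where the rotation starts, so it is computed for the one that starts
-- at `i`, where only the first letter is `i`.
occurrences-rotation : ∀ {M} .{{_ : NonZero M}} (i : Fin M) k →
                       occurrences i (applyUpTo (λ t → (t + k) mod M) M) ≡ 1
occurrences-rotation {M@(suc M′)} i k = trans (to-0 k) (trans (sym (to-0 (toℕ i))) at-i)
  where
  rotation : ℕ → Word M
  rotation k = applyUpTo (λ t → (t + k) mod M) M

  step : ∀ k → occurrences i (rotation (suc k)) ≡ occurrences i (rotation k)
  -- The `suc M` letters from `k` on begin and end with the same letter; removing the first or the
  -- last gives the two rotations.
  step k = +-cancelˡ-≡ (occurrences i [ k mod M ]) _ _ (begin
    occurrences i [ k mod M ] + occurrences i (rotation (suc k))
      ≡⟨ cong (λ w → occurrences i [ k mod M ] + occurrences i w)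
              (applyUpTo-cong (λ t → cong (_mod M) (+-suc t k)) M) ⟩
    occurrences i [ k mod M ] + occurrences i (applyUpTo (f ∘ suc) M)
      ≡⟨ occurrences-∷ i (k mod M) (applyUpTo (f ∘ suc) M) ⟨
    occurrences i (applyUpTo f (suc M))
      ≡⟨ cong (occurrences i) (applyUpTo-∷ʳ f M) ⟨
    occurrences i (rotation k ++ [ (M + k) mod M ])
      ≡⟨ occurrences-∷ʳ i _ (rotation k) ⟩
    occurrences i [ (M + k) mod M ] + occurrences i (rotation k)
      ≡⟨ cong (λ j → occurrences i [ j ] + occurrences i (rotation k))
              (trans (cong (_mod M) (+-comm M k)) (mod-+M k)) ⟩
    occurrences i [ k mod M ] + occurrences i (rotation k) ∎)
    where
    open ≡-Reasoning
    f : ℕ → Fin M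
    f t = (t + k) mod M

  to-0 : ∀ k → occurrences i (rotation k) ≡ occurrences i (rotation 0)
  to-0 zero    = refl
  to-0 (suc k) = trans (step k) (to-0 k)

  once : ∀ {t} → t < M′ → (suc t + toℕ i) mod M ≢ i
  once {t} t<M′ eq with mod-≡⇒multiple (m≤n+m (toℕ i) (suc t)) (trans (toℕ-mod-id i) (sym eq))
  ... | v , 1+t+i≡ with v | +-cancelʳ-≡ (toℕ i) _ _ (trans 1+t+i≡ (+-comm (toℕ i) (v * M)))
  ...   | suc v′ | 1+t≡ = <⇒≱ t<M′ (≤-trans (m≤m+n M′ (v′ * M)) (≤-reflexive (suc-injective (sym 1+t≡))))

  at-i : occurrences i (rotation (toℕ i)) ≡ 1
  at-i = trans (occurrences-∷ i (toℕ i mod M) _) (cong₂ _+_ first (occurrences-≡0 M′ once))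
    where
    first : occurrences i [ toℕ i mod M ] ≡ 1
    first rewrite toℕ-mod-id i with i ≟ i
    ... | yes _  = refl
    ... | no i≢i = contradiction refl i≢i

-- (a , b , c) stands for a + b z + c u. With x = 2z + u + 2 and n = 3z + 2u + 3
-- every quantity below is such a form without subtraction, and the inequalities
-- needed hold coefficientwise, so that they are decided by evaluation.
Form : Set
Form = ℕ × ℕ × ℕ

infixl 6 _⊕_
_⊕_ : Form → Form → Form
(a , b , c) ⊕ (a′ , b′ , c′) = a + a′ , b + b′ , c + c′

_·_ : ℕ → Form → Form
k · (a , b , c) = k * a , k * b , k * c

infix 4 _≺_ _≺?_
-- The strict inequality sits in the constant term because `z` and `u` may be 0.
_≺_ : Form → Form → Set
(a , b , c) ≺ (a′ , b′ , c′) = a < a′ × b ≤ b′ × c ≤ c′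

_≺?_ : ∀ f g → Dec (f ≺ g)
(a , b , c) ≺? (a′ , b′ , c′) = a <? a′ ×-dec b ≤? b′ ×-dec c ≤? c′

n̂ x̂ m̂ : Form
n̂ = 3 , 3 , 2
x̂ = 2 , 2 , 1
m̂ = 6 , 6 , 4

-- 0, x − 1, x, 2x − 1 and n + x − 1: letter i is in slot s of the blocks congruent
-- to i + offset s modulo 2n.
offset : Fin 5 → Form
offset 0F = 0 , 0 , 0
offset 1F = 1 , 2 , 1
offset 2F = 2 , 2 , 1
offset 3F = 3 , 4 , 2
offset 4F = 4 , 5 , 3

-- The negated offsets modulo 2n.
slot : Fin 5 → Form
slot 0F = 6 , 6 , 4
slot 1F = 5 , 4 , 3
slot 2F = 4 , 4 , 3
slot 3F = 3 , 2 , 2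
slot 4F = 2 , 1 , 1

-- Slot 0 fits in because its entry is `2n` rather than 0.
slot⊕offset : ∀ s → slot s ⊕ offset s ≡ m̂
slot⊕offset 0F = refl
slot⊕offset 1F = refl
slot⊕offset 2F = refl
slot⊕offset 3F = refl
slot⊕offset 4F = refl

-- Letter 0 stands at index `s` of block `offset s`, and a block has five letters.
base : Fin 5 → Form
base s = 5 · offset s ⊕ (toℕ s , 0 , 0)

-- The progression of occurrences of letter 0 in increasing order; a full turn of `2n` blocks adds
-- `5 · m̂`.
position : ℕ → Form
position 0 = base 0F
position 1 = base 1F
position 2 = base 2F
position 3 = base 3F
position 4 = base 4F
position (suc (suc (suc (suc (suc k))))) = 5 · m̂ ⊕ position k

Interlaced : Form → ℕ → ℕ → Set
Interlaced d r k =
  position (k + r) ≺ 5 · d ⊕ position k × 5 · d ⊕ position k ≺ position (suc k + r)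

-- Five cases decide all: replacing `k` by `5 + k` adds `5 · m̂` to every position compared.
interlaced? : ∀ d r → Dec (∀ (s : Fin 5) → Interlaced d r (toℕ s))
interlaced? d r = Fin.all? λ s →
  (position (toℕ s + r) ≺? 5 · d ⊕ position (toℕ s))
  ×-dec (5 · d ⊕ position (toℕ s) ≺? position (suc (toℕ s) + r))

-- Positions and letters for given parameters

module Construction (z u : ℕ) where

  ⟦_⟧ : Form → ℕ
  ⟦ a , b , c ⟧ = a + (b * z + c * u)

  n x M : ℕ
  n = ⟦ n̂ ⟧
  x = ⟦ x̂ ⟧
  M = 2 * n

  ⟦⊕⟧ : ∀ f g → ⟦ f ⊕ g ⟧ ≡ ⟦ f ⟧ + ⟦ g ⟧
  ⟦⊕⟧ (a , b , c) (a′ , b′ , c′) = lemma a b c a′ b′ c′ z u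
    where
    lemma : ∀ a b c a′ b′ c′ z u → (a + a′) + ((b + b′) * z + (c + c′) * u) ≡
                                   a + (b * z + c * u) + (a′ + (b′ * z + c′ * u))
    lemma = solve-∀

  ⟦·⟧ : ∀ k f → ⟦ k · f ⟧ ≡ k * ⟦ f ⟧
  ⟦·⟧ k (a , b , c) = lemma k a b c z u
    where
    lemma : ∀ k a b c z u → k * a + (k * b * z + k * c * u) ≡ k * (a + (b * z + c * u))
    lemma = solve-∀

  ⟦constant⟧ : ∀ k → ⟦ k , 0 , 0 ⟧ ≡ k
  ⟦constant⟧ k = +-identityʳ k

  ⟦m̂⟧ : ⟦ m̂ ⟧ ≡ M
  ⟦m̂⟧ = ⟦·⟧ 2 n̂

  ≺⇒< : ∀ {f g} → f ≺ g → ⟦ f ⟧ < ⟦ g ⟧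
  ≺⇒< (a< , b≤ , c≤) = +-mono-<-≤ a< (+-mono-≤ (*-monoˡ-≤ z b≤) (*-monoˡ-≤ u c≤))

  P : ℕ → ℕ
  P k = ⟦ position k ⟧

  P-period : ∀ k → P (5 + k) ≡ M * 5 + P k
  P-period k = trans (⟦⊕⟧ (5 · m̂) (position k))
    (cong (_+ P k) (trans (⟦·⟧ 5 m̂) (trans (cong (5 *_) ⟦m̂⟧) (*-comm 5 M))))

  P-base : ∀ s → P (toℕ s) ≡ ⟦ offset s ⟧ * 5 + toℕ s
  P-base s = trans (cong ⟦_⟧ (position-base s))
    (trans (⟦⊕⟧ (5 · offset s) (toℕ s , 0 , 0))
      (cong₂ _+_ (trans (⟦·⟧ 5 (offset s)) (*-comm 5 ⟦ offset s ⟧)) (⟦constant⟧ (toℕ s))))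
    where
    position-base : ∀ s → position (toℕ s) ≡ base s
    position-base 0F = refl
    position-base 1F = refl
    position-base 2F = refl
    position-base 3F = refl
    position-base 4F = refl

  P-periods : ∀ v k → P (v * 5 + k) ≡ v * (M * 5) + P k
  P-periods zero    k = refl
  P-periods (suc v) k = trans (P-period (v * 5 + k))
    (trans (cong (M * 5 +_) (P-periods v k)) (sym (+-assoc (M * 5) _ _)))

  slot+offset : ∀ s → ⟦ slot s ⟧ + ⟦ offset s ⟧ ≡ M
  slot+offset s = trans (sym (⟦⊕⟧ (slot s) (offset s))) (trans (cong ⟦_⟧ (slot⊕offset s)) ⟦m̂⟧)

  interlaced : ∀ d r {_ : True (interlaced? d r)} k →
    P (k + r) < ⟦ d ⟧ * 5 + P k × ⟦ d ⟧ * 5 + P k < P (suc k + r)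
  interlaced d r {ok} = go
    where
    5d+ : ∀ k → ⟦ 5 · d ⊕ position k ⟧ ≡ ⟦ d ⟧ * 5 + P k
    5d+ k = trans (⟦⊕⟧ (5 · d) (position k)) (cong (_+ P k) (trans (⟦·⟧ 5 d) (*-comm 5 ⟦ d ⟧)))
    start : ∀ (s : Fin 5) → let k = toℕ s in
      P (k + r) < ⟦ d ⟧ * 5 + P k × ⟦ d ⟧ * 5 + P k < P (suc k + r)
    start s with toWitness ok s
    ... | A<B , B<A =
      <-≤-trans (≺⇒< {position (toℕ s + r)} {5 · d ⊕ position (toℕ s)} A<B)
              (≤-reflexive (5d+ (toℕ s))) ,
      ≤-<-trans (≤-reflexive (sym (5d+ (toℕ s))))
              (≺⇒< {5 · d ⊕ position (toℕ s)} {position (suc (toℕ s) + r)} B<A)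
    go : ∀ k → P (k + r) < ⟦ d ⟧ * 5 + P k × ⟦ d ⟧ * 5 + P k < P (suc k + r)
    go 0 = start 0F
    go 1 = start 1F
    go 2 = start 2F
    go 3 = start 3F
    go 4 = start 4F
    go (suc (suc (suc (suc (suc k))))) with go k
    ... | A<B , B<A =
      subst₂ _<_ (sym (P-period (k + r))) (sym B≡) (+-monoʳ-< (M * 5) A<B) ,
      subst₂ _<_ (sym B≡) (sym (P-period (suc k + r))) (+-monoʳ-< (M * 5) B<A)
      where
      B≡ : ⟦ d ⟧ * 5 + P (5 + k) ≡ M * 5 + (⟦ d ⟧ * 5 + P k)
      B≡ = trans (cong (⟦ d ⟧ * 5 +_) (P-period k)) (lemma (⟦ d ⟧ * 5) (M * 5) (P k))
        where
        lemma : ∀ a b c → a + (b + c) ≡ b + (a + c)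
        lemma = solve-∀

  letter : Fin 5 → ℕ → Fin M
  letter s q = (q + ⟦ slot s ⟧) mod M

  -- Reading starts at block `q`. Recursion by five lets whole blocks unfold by computation, as
  -- `occurrences-blocks` and `drop-blocks` require.
  letters : ℕ → ℕ → Fin M
  letters q 0 = letter 0F q
  letters q 1 = letter 1F q
  letters q 2 = letter 2F q
  letters q 3 = letter 3F q
  letters q 4 = letter 4F q
  letters q (suc (suc (suc (suc (suc t))))) = letters (suc q) t

  letters-blocks : ∀ q c t → letters q (c * 5 + t) ≡ letters (c + q) t
  letters-blocks q zero    t = refl
  letters-blocks q (suc c) t = trans (letters-blocks (suc q) c t) (cong (λ q → letters q t) (+-suc c q))

  letters-slot : ∀ q s → letters q (toℕ s) ≡ letter s q
  letters-slot q 0F = refl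
  letters-slot q 1F = refl
  letters-slot q 2F = refl
  letters-slot q 3F = refl
  letters-slot q 4F = refl

  W : ℕ → Fin M
  W = letters 0

  W-block : ∀ q s → W (q * 5 + toℕ s) ≡ letter s q
  W-block q s = trans (letters-blocks 0 q (toℕ s))
    (trans (letters-slot (q + 0) s) (cong (letter s) (+-identityʳ q)))

  W-base : ∀ a s → W (a * 5 + P (toℕ s)) ≡ a mod M
  W-base a s = begin
    W (a * 5 + P (toℕ s))                   ≡⟨ cong (λ p → W (a * 5 + p)) (P-base s) ⟩
    W (a * 5 + (⟦ offset s ⟧ * 5 + toℕ s))  ≡⟨ cong W (lemma a ⟦ offset s ⟧ (toℕ s)) ⟩
    W ((a + ⟦ offset s ⟧) * 5 + toℕ s)      ≡⟨ W-block (a + ⟦ offset s ⟧) s ⟩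
    (a + ⟦ offset s ⟧ + ⟦ slot s ⟧) mod M   ≡⟨ cong (_mod M) (+-assoc a _ _) ⟩
    (a + (⟦ offset s ⟧ + ⟦ slot s ⟧)) mod M
      ≡⟨ cong (λ b → (a + b) mod M) (trans (+-comm ⟦ offset s ⟧ _) (slot+offset s)) ⟩
    (a + M) mod M                           ≡⟨ mod-+M a ⟩
    a mod M                                 ∎
    where
    open ≡-Reasoning
    lemma : ∀ a c s → a * 5 + (c * 5 + s) ≡ (a + c) * 5 + s
    lemma = solve-∀

  W-P : ∀ a k → W (a * 5 + P k) ≡ a mod M
  W-P a 0 = W-base a 0F
  W-P a 1 = W-base a 1F
  W-P a 2 = W-base a 2F
  W-P a 3 = W-base a 3F
  W-P a 4 = W-base a 4F
  W-P a (suc (suc (suc (suc (suc k))))) = trans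
    (cong W (trans (cong (a * 5 +_) (P-period k)) (lemma a M (P k))))
    (trans (W-P (a + M) k) (mod-+M a))
    where
    lemma : ∀ a m p → a * 5 + (m * 5 + p) ≡ (a + m) * 5 + p
    lemma = solve-∀

  -- The periodic word is read from block 3 · 2n on, since a + d may reach 2 · 2n and
  -- occurrences of a letter before the start of its progression must not interfere.
  T : ℕ
  T = 3 * M * 5

  -- The letter at slot `s` of block `q` gives `q + e ≡ a + v * M` with `v` at least 2. One multiple
  -- of `M` is absorbed by `slot s` and `offset s`; another yields the `5` in `5 + k`, the room for
  -- an index shift by `r`.
  W-P⁻¹ : ∀ {a} → a < 2 * M → ∀ t → W (T + t) ≡ a mod M → ∃[ k ] T + t ≡ a * 5 + P (5 + k)
  W-P⁻¹ {a} a<2M t Wt with t divMod 5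
  ... | result q₀ s t≡ = solution (mod-≡⇒multiple a≤q+e
      (trans (sym Wt) (trans (cong W T+t≡) (W-block q s))))
    where
    q e c : ℕ
    q = 3 * M + q₀
    e = ⟦ slot s ⟧
    c = ⟦ offset s ⟧
    T+t≡ : T + t ≡ q * 5 + toℕ s
    T+t≡ = trans (cong (T +_) (trans t≡ (+-comm (toℕ s) _))) (lemma (3 * M) q₀ (toℕ s))
      where
      lemma : ∀ m q s → m * 5 + (q * 5 + s) ≡ (m + q) * 5 + s
      lemma = solve-∀
    3M≤q+e : 3 * M ≤ q + e
    3M≤q+e = ≤-trans (m≤m+n (3 * M) q₀) (m≤m+n q e)
    a≤q+e : a ≤ q + e
    a≤q+e = ≤-trans (<⇒≤ a<2M) (≤-trans (*-monoˡ-≤ M {2} {3} (n≤1+n 2)) 3M≤q+e)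
    -- For `v` at most 1, `q + e` would be less than `2 * M + 1 * M`, but reading starts at block
    -- `3 * M`.
    large : ∀ v → q + e ≡ a + v * M → 1 < v
    large v q+e≡ with 1 <? v
    ... | yes 1<v = 1<v
    ... | no  1≮v = contradiction
      (≤-<-trans
        (≤-trans 3M≤q+e (≤-trans (≤-reflexive q+e≡) (+-monoʳ-≤ a (*-monoˡ-≤ M (≮⇒≥ 1≮v)))))
        (+-monoˡ-< (1 * M) a<2M))
      (≤⇒≯ (≤-reflexive (lemma M)))
      where
      lemma : ∀ m → 2 * m + 1 * m ≡ 3 * m
      lemma = solve-∀
    solution : ∃[ v ] q + e ≡ a + v * M → ∃[ k ] T + t ≡ a * 5 + P (5 + k)
    solution (v , q+e≡) with v | q+e≡ | large v q+e≡
    ... | 1           | _     | s≤s ()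
    ... | suc (suc v) | q+e≡′ | _ = v * 5 + toℕ s , (begin
      T + t                                  ≡⟨ T+t≡ ⟩
      q * 5 + toℕ s                          ≡⟨ cong (λ q → q * 5 + toℕ s) q≡ ⟩
      (a + c + suc v * M) * 5 + toℕ s        ≡⟨ lemma a c (suc v) M (toℕ s) ⟩
      a * 5 + (suc v * (M * 5) + (c * 5 + toℕ s)) ≡⟨ cong (λ p → a * 5 + (suc v * (M * 5) + p)) (P-base s) ⟨
      a * 5 + (suc v * (M * 5) + P (toℕ s))  ≡⟨ cong (a * 5 +_) (P-periods (suc v) (toℕ s)) ⟨
      a * 5 + P (suc v * 5 + toℕ s)          ∎)
      where
      open ≡-Reasoning
      lemma : ∀ a c v m s → (a + c + v * m) * 5 + s ≡ a * 5 + (v * (m * 5) + (c * 5 + s))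
      lemma = solve-∀
      lemma₂ : ∀ a w c m → a + (m + w) + c ≡ a + c + w + m
      lemma₂ = solve-∀
      q≡ : q ≡ a + c + suc v * M
      q≡ = +-cancelʳ-≡ M _ _ (begin
        q + M                       ≡⟨ cong (q +_) (slot+offset s) ⟨
        q + (e + c)                 ≡⟨ +-assoc q e c ⟨
        q + e + c                   ≡⟨ cong (_+ c) q+e≡′ ⟩
        a + suc (suc v) * M + c     ≡⟨ lemma₂ a (suc v * M) c M ⟩
        a + c + suc v * M + M       ∎)

  word : Word M
  word = applyUpTo (λ t → W (T + t)) (M * 5)

  word≡ : word ≡ applyUpTo (letters (3 * M)) (M * 5)
  word≡ = applyUpTo-cong (λ t → trans (letters-blocks 0 (3 * M) t)
    (cong (λ q → letters q t) (+-identityʳ (3 * M)))) (M * 5)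

  shift-alternates : ∀ d r {_ : True (interlaced? d r)} {r≤5 : True (r ≤? 5)} {i j} →
    ⟦ d ⟧ ≤ M → Shift ⟦ d ⟧ i j → Alternate i j word
  shift-alternates d r {ok} {r≤5} d≤M (a , a<M , refl , refl) = interlaced⇒Alternate W T
    (λ k → a * 5 + P k) (λ k → (a + ⟦ d ⟧) * 5 + P k) r
    (W-P a) (W-P (a + ⟦ d ⟧))
    (λ t Wt → let k , t≡ = W-P⁻¹ (<-≤-trans a<M (m≤m+n M _)) t Wt in
      -- The index `5 + k` is rewritten as `k + (5 ∸ r) + r`, the shape demanded of `A`.
      k + (5 ∸ r) , trans t≡ (cong (λ h → a * 5 + P h) (sym (trans (+-assoc k _ r)
        (trans (cong (k +_) (m∸n+n≡m (toWitness r≤5))) (+-comm k 5))))))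
    (λ t Wt → let k , t≡ = W-P⁻¹ a+d<2M t Wt in 5 + k , t≡)
    (λ k → let A<B , B<A = interlaced d r {ok} k in
      <-≤-trans (+-monoʳ-< (a * 5) A<B) (≤-reflexive (B≡ k)) ,
      ≤-<-trans (≤-reflexive (sym (B≡ k))) (+-monoʳ-< (a * 5) B<A))
    (M * 5)
    where
    a+d<2M : a + ⟦ d ⟧ < 2 * M
    a+d<2M = <-≤-trans (+-mono-<-≤ a<M d≤M) (≤-reflexive (cong (M +_) (sym (+-identityʳ M))))
    B≡ : ∀ k → a * 5 + (⟦ d ⟧ * 5 + P k) ≡ (a + ⟦ d ⟧) * 5 + P k
    B≡ k = lemma a ⟦ d ⟧ (P k)
      where
      lemma : ∀ a d p → a * 5 + (d * 5 + p) ≡ (a + d) * 5 + p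
      lemma = solve-∀

  -- Uniformity of the word

  -- Counting slot by slot is useful because over `M` consecutive blocks each slot runs through a
  -- rotation of the alphabet.
  occurrences-blocks : ∀ i q L → let count s = occurrences i (applyUpTo (λ t → letter s (t + q)) L) in
    occurrences i (applyUpTo (letters q) (L * 5)) ≡
    count 0F + (count 1F + (count 2F + (count 3F + count 4F)))
  occurrences-blocks i q zero    = refl
  occurrences-blocks i q (suc L) = begin
    occurrences i (applyUpTo (letters q) (suc L * 5))
      ≡⟨ occurrences-∷ i (letter 0F q) _ ⟩
    o 0F + occurrences i (letter 1F q ∷ letter 2F q ∷ letter 3F q ∷ letter 4F q ∷ rest)
      ≡⟨ cong (o 0F +_) (occurrences-∷ i (letter 1F q) _) ⟩
    o 0F + (o 1F + occurrences i (letter 2F q ∷ letter 3F q ∷ letter 4F q ∷ rest))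
      ≡⟨ cong (λ k → o 0F + (o 1F + k)) (occurrences-∷ i (letter 2F q) _) ⟩
    o 0F + (o 1F + (o 2F + occurrences i (letter 3F q ∷ letter 4F q ∷ rest)))
      ≡⟨ cong (λ k → o 0F + (o 1F + (o 2F + k))) (occurrences-∷ i (letter 3F q) _) ⟩
    o 0F + (o 1F + (o 2F + (o 3F + occurrences i (letter 4F q ∷ rest))))
      ≡⟨ cong (λ k → o 0F + (o 1F + (o 2F + (o 3F + k)))) (occurrences-∷ i (letter 4F q) _) ⟩
    o 0F + (o 1F + (o 2F + (o 3F + (o 4F + occurrences i rest))))
      ≡⟨ cong (λ k → o 0F + (o 1F + (o 2F + (o 3F + (o 4F + k))))) (occurrences-blocks i (suc q) L) ⟩
    o 0F + (o 1F + (o 2F + (o 3F + (o 4F + (r 0F + (r 1F + (r 2F + (r 3F + r 4F))))))))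
      ≡⟨ lemma (o 0F) (o 1F) (o 2F) (o 3F) (o 4F) (r 0F) (r 1F) (r 2F) (r 3F) (r 4F) ⟩
    o 0F + r 0F + (o 1F + r 1F + (o 2F + r 2F + (o 3F + r 3F + (o 4F + r 4F))))
      ≡⟨ cong₂ _+_ (join 0F) (cong₂ _+_ (join 1F) (cong₂ _+_ (join 2F) (cong₂ _+_ (join 3F) (join 4F)))) ⟩
    count 0F + (count 1F + (count 2F + (count 3F + count 4F))) ∎
    where
    open ≡-Reasoning
    rest : Word M
    rest = applyUpTo (letters (suc q)) (L * 5)
    count o r : Fin 5 → ℕ
    count s = occurrences i (applyUpTo (λ t → letter s (t + q)) (suc L))
    o s = occurrences i [ letter s q ]
    r s = occurrences i (applyUpTo (λ t → letter s (t + suc q)) L)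
    join : ∀ s → o s + r s ≡ count s
    join s = trans
      (cong (λ w → o s + occurrences i w) (applyUpTo-cong (λ t → cong (letter s) (+-suc t q)) L))
      (sym (occurrences-∷ i (letter s q) _))
    lemma : ∀ a b c d e a′ b′ c′ d′ e′ →
      a + (b + (c + (d + (e + (a′ + (b′ + (c′ + (d′ + e′)))))))) ≡
      a + a′ + (b + b′ + (c + c′ + (d + d′ + (e + e′))))
    lemma = solve-∀

  occurrences-slot : ∀ i s q → occurrences i (applyUpTo (λ t → letter s (t + q)) M) ≡ 1
  occurrences-slot i s q = trans
    (cong (occurrences i) (applyUpTo-cong (λ t → cong (_mod M) (+-assoc t q ⟦ slot s ⟧)) M))
    (occurrences-rotation i (q + ⟦ slot s ⟧))

  word-uniform : Uniform 5 word
  word-uniform i = trans (cong (occurrences i) word≡) (trans (occurrences-blocks i (3 * M) M)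
    (cong₂ _+_ (o 0F) (cong₂ _+_ (o 1F) (cong₂ _+_ (o 2F) (cong₂ _+_ (o 3F) (o 4F))))))
    where
    o : ∀ s → occurrences i (applyUpTo (λ t → letter s (t + 3 * M)) M) ≡ 1
    o s = occurrences-slot i s (3 * M)

  -- Adjacent letters alternate

  Jumps : List ℕ
  Jumps = x ∷ 1 ∷ n ∷ []

  x≤n : x ≤ n
  x≤n = <⇒≤ (≺⇒< {x̂} {n̂} (s≤s (s≤s (s≤s z≤n)) , s≤s (s≤s z≤n) , s≤s z≤n))

  jump≤n : ∀ {d} → d ∈ Jumps → d ≤ n
  jump≤n (here refl)                 = x≤n
  jump≤n (there (here refl))         = s≤s z≤n
  jump≤n (there (there (here refl))) = ≤-refl

  -- The index shifts 1, 0, 2 can be read off at `k = 0`: 5x - 4 < 5x < 5x + 2, then 0 < 5 < 5x - 4,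
  -- then 5x + 2 < 5n < 10x - 2. For the jump `x` at `k = 3` the condition 5n + 5x - 1 < 15x - 2 <
  -- 10n amounts to n < 2x and 3x ≤ 2n.
  jump-alternates : ∀ {d i j} → d ∈ Jumps → Shift d i j → Alternate i j word
  jump-alternates (here refl) = shift-alternates x̂ 1 (≤-trans x≤n (m≤m+n n _))
  jump-alternates (there (here refl)) = shift-alternates (1 , 0 , 0) 0 (s≤s z≤n)
  jump-alternates (there (there (here refl))) = shift-alternates n̂ 2 (m≤m+n n _)

  adjacent⇒Alternate : ∀ i j → circularDistance i j ∈ Jumps → Alternate i j word
  adjacent⇒Alternate i j d∈ with circularDistance⇒Shift i j
  ... | inj₁ shift = jump-alternates d∈ shift
  ... | inj₂ shift = Alternate-sym {w = word} (jump-alternates d∈ shift)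

  -- Non-adjacent letters do not alternate

  mod-jump : ∀ {a d b} → d ∈ Jumps → a + d ≡ b → circularDistance (a mod M) (b mod M) ∈ Jumps
  mod-jump {a} {d} d∈ refl =
    subst (_∈ Jumps) (sym (circularDistance-mod a d (*-monoʳ-≤ 2 (jump≤n d∈)))) d∈

  mod-jump′ : ∀ {a d b} → d ∈ Jumps → a + d ≡ b → circularDistance (b mod M) (a mod M) ∈ Jumps
  mod-jump′ {a} {d} {b} d∈ eq =
    subst (_∈ Jumps) (circularDistance-sym (a mod M) (b mod M)) (mod-jump d∈ eq)

  drop-blocks : ∀ {i j} q b L → Alternate i j (applyUpTo (letters q) ((b + L) * 5)) →
                Alternate i j (applyUpTo (letters (b + q)) (L * 5))
  drop-blocks q zero    L alt = alt
  drop-blocks {i} {j} q (suc b) L alt =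
    subst (λ q → Alternate i j (applyUpTo (letters q) (L * 5))) (+-suc b q)
      (drop-blocks (suc q) b L
        (Alternate-tail {z = letter 4F q} (Alternate-tail {z = letter 3F q}
          (Alternate-tail {z = letter 2F q} (Alternate-tail {z = letter 1F q}
            (Alternate-tail {z = letter 0F q} alt))))))

  -- Slot 1 of one block and slot 2 of the next carry the same letter, and all
  -- letters in between are its neighbours.
  block⇒¬Alternate : ∀ {i j} b → suc b < M → letter 1F (b + 3 * M) ≡ i → i ≢ j →
                     ¬ circularDistance i j ∈ Jumps → ¬ Alternate i j word
  block⇒¬Alternate {j = j} b 1+b<M refl i≢j nonadjacent alt with m≤n⇒∃[o]m+o≡n 1+b<M
  ... | L , 2+b+L≡M = repeat⇒¬Alternate mid i≢j
      -- The relations between slots hold by evaluation of forms; for instance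
      -- `slot 2F ⊕ (1 , 0 , 0)` is `slot 1F`, so the first letter of `mid` is i - 1.
      ( avoids (mod-jump′ (there (here refl)) (plus (slot 2F) (1 , 0 , 0)))
      ∷ avoids (mod-jump′ (here refl) (plus (slot 3F) x̂))
      ∷ avoids (mod-jump′ (there (there (here refl))) (plus (slot 4F) n̂))
      ∷ avoids (mod-jump (here refl) (trans (plus (slot 1F) x̂) (+-suc q ⟦ slot 0F ⟧)))
      ∷ avoids (mod-jump (there (here refl)) (+-comm (q + ⟦ slot 1F ⟧) 1))
      ∷ []) alt′
    where
    q : ℕ
    q = b + 3 * M
    i : Fin M
    i = letter 1F q
    mid post : Word M
    mid = letter 2F q ∷ letter 3F q ∷ letter 4F q ∷ letter 0F (suc q) ∷ letter 1F (suc q) ∷ []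
    post = letter 3F (suc q) ∷ letter 4F (suc q) ∷ applyUpTo (letters (2 + q)) (L * 5)
    avoids : ∀ {k} → circularDistance i k ∈ Jumps → k ≢ j
    avoids k∈ refl = nonadjacent k∈
    plus : ∀ f g → q + ⟦ f ⟧ + ⟦ g ⟧ ≡ q + ⟦ f ⊕ g ⟧
    plus f g = trans (+-assoc q ⟦ f ⟧ ⟦ g ⟧) (cong (q +_) (sym (⟦⊕⟧ f g)))
    M≡ : M ≡ b + (2 + L)
    M≡ = trans (sym 2+b+L≡M) (sym (trans (+-suc b (suc L)) (cong suc (+-suc b L))))
    -- By `suc b < M` at least two blocks remain after the first `b`, enough to contain both copies
    -- of `i`.
    suffix : Alternate i j (letter 0F q ∷ i ∷ mid ++ letter 2F (suc q) ∷ post)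
    suffix = drop-blocks (3 * M) b (2 + L)
      (subst (Alternate i j) (trans word≡ (cong (λ k → applyUpTo (letters (3 * M)) (k * 5)) M≡)) alt)
    alt′ : Alternate i j (i ∷ mid ++ i ∷ post)
    alt′ = subst (λ k → Alternate i j (i ∷ mid ++ k ∷ post))
      (cong (_mod M) (sym (+-suc q ⟦ slot 2F ⟧)))
      (Alternate-tail {z = letter 0F q} suffix)

  slot1-block : ∀ i → ∃[ b ] b < M × i ≡ letter 1F (b + 3 * M)
  slot1-block i = ∈-applyUpTo⁻ _ (occurs⇒∈ (occurrences-slot i 1F (3 * M)))

  nonadjacent⇒¬Alternate : ∀ i j → i ≢ j → ¬ circularDistance i j ∈ Jumps → ¬ Alternate i j word
  nonadjacent⇒¬Alternate i j i≢j nonadjacent alt with slot1-block i | slot1-block j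
  ... | b , b<M , i≡ | b′ , b′<M , j≡ with suc b <? M | suc b′ <? M
  ...   | yes 1+b<M | _ = block⇒¬Alternate b 1+b<M (sym i≡) i≢j nonadjacent alt
  ...   | no _ | yes 1+b′<M = block⇒¬Alternate b′ 1+b′<M (sym j≡) (i≢j ∘ sym)
          (nonadjacent ∘ subst (_∈ Jumps) (circularDistance-sym j i)) (Alternate-sym {w = word} alt)
  -- Both letters would occupy slot 1 of the last block.
  ...   | no 1+b≮M | no 1+b′≮M = i≢j (trans i≡ (trans (cong (λ b → letter 1F (b + 3 * M)) b≡b′) (sym j≡)))
    where
    b≡b′ : b ≡ b′
    b≡b′ = suc-injective (trans (≤-antisym b<M (≮⇒≥ 1+b≮M)) (sym (≤-antisym b′<M (≮⇒≥ 1+b′≮M))))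

  representable : ∀ (1<x : 1 < x) (x<n : x < n) → Representable 5 (circulant₂ₙ n x 1<x x<n)
  representable 1<x x<n = word , word-uniform , (λ i → occurs⇒∈ (word-uniform i)) ,
    λ i j i≢j → mk⇔ (adjacent⇒Alternate i j) λ alt →
      decidable-stable (DecMembership._∈?_ ℕ._≟_ (circularDistance i j) Jumps) λ nonadjacent →
        nonadjacent⇒¬Alternate i j i≢j nonadjacent alt

-- From the range of x to the parameters

-- The parameters are the slacks of the hypotheses: `z` is 2x - n - 1 and `u` is 2n - 3x. They are
-- reached through `y`, which is n - x - 1, with `z` equal to x - 2 - y and `u` to y - z.
parametrization : ∀ {n x} → x < n → n < 2 * x → 3 * x ≤ 2 * n →
  ∃[ z ] ∃[ u ] n ≡ Construction.n z u × x ≡ Construction.x z u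
parametrization {n} {x} x<n n<2x 3x≤2n with m≤n⇒∃[o]m+o≡n x<n
... | y , refl with m≤n⇒∃[o]m+o≡n y+2≤x
  where
  y+2≤x : 2 + y ≤ x
  y+2≤x = +-cancelˡ-≤ x _ _ (subst₂ _≤_ (lemma x y) (cong (x +_) (+-identityʳ x)) n<2x)
    where
    lemma : ∀ x y → suc (suc x + y) ≡ x + (2 + y)
    lemma = solve-∀
... | z , refl with m≤n⇒∃[o]m+o≡n z≤y
  where
  z≤y : z ≤ y
  z≤y = +-cancelˡ-≤ (6 + y * 3 + z * 2) _ _ (subst₂ _≤_ (lemma y z) (lemma′ y z) 3x≤2n)
    where
    lemma : ∀ y z → 3 * (2 + y + z) ≡ 6 + y * 3 + z * 2 + z
    lemma = solve-∀
    lemma′ : ∀ y z → 2 * (suc (2 + y + z) + y) ≡ 6 + y * 3 + z * 2 + y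
    lemma′ = solve-∀
... | u , refl = z , u , lemma z u , lemma′ z u
  where
  lemma : ∀ z u → suc (2 + (z + u) + z) + (z + u) ≡ 3 + (3 * z + 2 * u)
  lemma = solve-∀
  lemma′ : ∀ z u → 2 + (z + u) + z ≡ 2 + (2 * z + 1 * u)
  lemma′ = solve-∀

theorem27 : (n x : ℕ) (1<x : 1 < x) (x<n : x < n) →
    n < 2 * x → 3 * x ≤ 2 * n →
    WordRepresentable (circulant₂ₙ n x 1<x x<n) ×
    (∃[ k ] (IsRepresentationNumber (circulant₂ₙ n x 1<x x<n) k × k ≤ 5))
theorem27 n x 1<x x<n n<2x 3x≤2n with parametrization x<n n<2x 3x≤2n
... | z , u , refl , refl =
  (proj₁ 5-representable , proj₂ (proj₂ 5-representable)) ,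
  least (representable? G (λ i j → DecMembership._∈?_ ℕ._≟_ (circularDistance i j) _)) 5-representable
  where
  G = circulant₂ₙ n x 1<x x<n
  5-representable : Representable 5 G
  5-representable = Construction.representable z u 1<x x<n
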